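{- Let $M, N$ be positive integers and let $k \geq 1$ be an integer (the number of colors). Then $$\sum_{n \ge 0}\ \sum_{\vec{t}} p_{M \times N} (\vec{t};n)\, x_1^{t_1} \cdots x_k^{t_k} q^n = \sum_{r=0}^{\min(M,N)} (x_1 + \cdots + x_k)^r f_{(M \times N; r)}(q),$$ where $\vec{t}=(t_1,\dots,t_k)$ runs over all nonnegative integer vectors in ${\mathbb{Z}_{\geq 0}}^k$, $p_{M\times N}(\vec{t};n)$ is the number of $(k,1)$-colored partitions of $n$ with at most $N$ parts, all of size at most $M$, in which exactly $t_i$ part sizes are of color $i$ for each $i=1,\dots,k$, and $f_{(M \times N; r)}(q)$ is the generating function for partitions in the $M \times N$ box with exactly $r$ different part sizes.
   Context: A $(k,1)$-colored partition of $n$ is a partition of $n$ in which each part is assigned one of $k$ colors, such that all parts of the same size have the same color (only one color is chosen per size of part). A partition lies in the $M \times N$ box if it has at most $N$ parts, each of size at most $M$. The generating function $f_{(M\times N;r)}(q)$ is $\sum_{\lambda} q^{|\lambda|}$, the sum being over all (uncolored) partitions $\lambda$ in the $M\times N$ box having exactly $r$ distinct part sizes, where $|\lambda|$ is the sum of the parts of $\lambda$; the empty partition has $r=0$. -}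

module Defs where

open import Data.Fin as Fin using (Fin)
import Data.Fin.Properties as Fin
open import Data.List
  using (List; []; _∷_; length; map; filter; foldr; upTo; allFin; cartesianProduct; cartesianProductWith; deduplicate)
open import Data.List.Membership.Propositional using (_∈_)
open import Data.List.Membership.Propositional.Properties
  using (∈-cartesianProductWith⁺; ∈-cartesianProductWith⁻)
open import Data.List.Properties using (∷-injective)
open import Data.List.Relation.Unary.All as All using (All; []; _∷_)
open import Data.List.Relation.Unary.AllPairs using (AllPairs; []; _∷_; allPairs?)
open import Data.List.Relation.Unary.Any using (here; there)
open import Data.List.Relation.Unary.Linked using (Linked; linked?)
open import Data.List.Relation.Unary.Unique.Propositional using (Unique)
import Data.List.Relation.Unary.Unique.Propositional.Properties as Unique
open import Data.Nat using (ℕ; zero; suc; _+_; _*_; _∸_; _≤_; _≥_; z≤n; s≤s)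
import Data.Nat.Properties as ℕ
open import Data.Nat.ListAction using (sum)
open import Data.Product using (_×_; _,_; proj₁; proj₂)
open import Data.Vec as Vec using (Vec; []; _∷_)
import Data.Vec.Properties as Vec
open import Relation.Binary.PropositionalEquality using (_≡_; refl)
open import Relation.Nullary using (Dec; yes; no; ¬_)
open import Relation.Nullary.Decidable using (_×-dec_; _→-dec_)

private variable
  A : Set
  m k : ℕ

-- Formal power series in m commuting variables with coefficients in ℕ:
-- a series sends an exponent vector to the coefficient of that monomial.
-- Equality of series is the pointwise equality _≗_.

Series : ℕ → Set
Series m = Vec ℕ m → ℕ

infixl 6 _⊕_
infixl 7 _⊗_
infixr 8 _^ˢ_

monomial : Vec ℕ m → Series m
monomial e e′ with Vec.≡-dec ℕ._≟_ e e′
... | yes _ = 1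
... | no  _ = 0

0ˢ : Series m
0ˢ _ = 0

1ˢ : Series m
1ˢ = monomial (Vec.replicate _ 0)

var : Fin m → Series m
var i = monomial (Vec.replicate _ 0 Vec.[ i ]≔ 1)

_⊕_ : Series m → Series m → Series m
(F ⊕ G) e = F e + G e

antidiagonal : ℕ → List (ℕ × ℕ)
antidiagonal n = map (λ i → i , n ∸ i) (upTo (suc n))

-- All pairs (u , v) of exponent vectors with u + v = e.
splits : Vec ℕ m → List (Vec ℕ m × Vec ℕ m)
splits []      = ([] , []) ∷ []
splits (n ∷ e) =
  cartesianProductWith (λ (i , j) (u , v) → i ∷ u , j ∷ v) (antidiagonal n) (splits e)

_⊗_ : Series m → Series m → Series m
(F ⊗ G) e = sum (map (λ (u , v) → F u * G v) (splits e))

_^ˢ_ : Series m → ℕ → Series m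
F ^ˢ zero  = 1ˢ
F ^ˢ suc n = F ⊗ F ^ˢ n

sumˢ : List (Series m) → Series m
sumˢ = foldr _⊕_ 0ˢ

-- In Series (suc k), variable 0 is q and variable i + 1 is the variable x
-- attached to the color i.

q : Series (suc k)
q = var Fin.zero

x : Fin k → Series (suc k)
x i = var (Fin.suc i)

-- genFun c = Σₙ Σₜ c(t; n) x₁^t₁ ⋯ x_k^t_k qⁿ
genFun : (Vec ℕ k → ℕ → ℕ) → Series (suc k)
genFun c (n ∷ t) = c t n

-- All words of length at most N over the given alphabet.
words≤ : ℕ → List A → List (List A)
words≤ zero    as = [] ∷ []
words≤ (suc N) as = [] ∷ cartesianProductWith _∷_ as (words≤ N as)

∈-words≤⁺ : ∀ N (as : List A) {w} → length w ≤ N → All (_∈ as) w → w ∈ words≤ N as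
∈-words≤⁺ zero    as {[]}    _       _        = here refl
∈-words≤⁺ (suc N) as {[]}    _       _        = here refl
∈-words≤⁺ (suc N) as {_ ∷ _} (s≤s l) (a ∷ ws) =
  there (∈-cartesianProductWith⁺ _∷_ a (∈-words≤⁺ N as l ws))

∈-words≤⁻ : ∀ N (as : List A) {w} → w ∈ words≤ N as → length w ≤ N × All (_∈ as) w
∈-words≤⁻ zero    as (here refl) = z≤n , []
∈-words≤⁻ (suc N) as (here refl) = z≤n , []
∈-words≤⁻ (suc N) as (there w∈)
  with _ , _ , a∈ , v∈ , refl ← ∈-cartesianProductWith⁻ _∷_ as (words≤ N as) w∈
  with l , vs ← ∈-words≤⁻ N as v∈ = s≤s l , a∈ ∷ vs

words≤-unique : ∀ N {as : List A} → Unique as → Unique (words≤ N as)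
words≤-unique zero    _ = [] ∷ []
words≤-unique (suc N) {as} u =
  All.tabulate nonempty ∷ Unique.cartesianProductWith⁺ _∷_ ∷-injective u (words≤-unique N u)
  where
  nonempty : ∀ {w} → w ∈ cartesianProductWith _∷_ as (words≤ N as) → ¬ [] ≡ w
  nonempty w∈ refl with ∈-cartesianProductWith⁻ _∷_ as (words≤ N as) w∈
  ... | _ , _ , _ , _ , ()

sizes : ℕ → List ℕ
sizes M = map suc (upTo M)

-- The partitions in the M × N box, as weakly decreasing lists of positive parts.
boxPartitions : ℕ → ℕ → List (List ℕ)
boxPartitions M N = filter (linked? ℕ._≥?_) (words≤ N (sizes M))

#distinct : List ℕ → ℕ
#distinct ps = length (deduplicate ℕ._≟_ ps)

f : (M N r : ℕ) → Series (suc k)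
f M N r =
  sumˢ (map (λ ps → q ^ˢ sum ps) (filter (λ ps → #distinct ps ℕ.≟ r) (boxPartitions M N)))

-- A (k,1)-colored partition is a list of pairs (size , color) with weakly
-- decreasing sizes, parts of equal size having equal colors. Since such parts
-- are then identical, each colored partition is represented by exactly one list.

IsColored : List (ℕ × Fin k) → Set
IsColored π =
  Linked _≥_ (map proj₁ π) × AllPairs (λ a b → proj₁ a ≡ proj₁ b → proj₂ a ≡ proj₂ b) π

isColored? : (π : List (ℕ × Fin k)) → Dec (IsColored π)
isColored? π =
  linked? ℕ._≥?_ (map proj₁ π)
  ×-dec allPairs? (λ a b → (proj₁ a ℕ.≟ proj₁ b) →-dec (proj₂ a Fin.≟ proj₂ b)) π

coloredBoxPartitions : ∀ k (M N : ℕ) → List (List (ℕ × Fin k))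
coloredBoxPartitions k M N =
  filter isColored? (words≤ N (cartesianProduct (sizes M) (allFin k)))

size : List (ℕ × Fin k) → ℕ
size π = sum (map proj₁ π)

-- Entry i is the number of distinct part sizes of color i.
colorType : List (ℕ × Fin k) → Vec ℕ k
colorType π =
  Vec.tabulate λ i → #distinct (map proj₁ (filter (λ part → proj₂ part Fin.≟ i) π))

p : (M N : ℕ) → Vec ℕ k → ℕ → ℕ
p {k} M N t n =
  length (filter (λ π → Vec.≡-dec ℕ._≟_ (colorType π) t ×-dec (size π ℕ.≟ n))
                 (coloredBoxPartitions k M N))

{-# OPTIONS --safe #-}
-- For a fixed partition with d distinct part sizes, a valid coloring amounts to
-- a free choice of a color for each distinct size: a part repeating the previous
-- size has its color forced, and a part of a new size multiplies the sum over the
-- colorings by x₁ + ⋯ + x_k. Summing over the partitions in the box, grouped by d,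
-- gives the identity; d ≤ min(M,N) since the d sizes are distinct elements of
-- {1,…,M} carried by at most N parts.
module Submission where

open import Defs
open import Data.Bool using (true; false; if_then_else_)
open import Data.Fin as Fin using (Fin)
import Data.Fin.Properties as Fin
open import Data.List
  using (List; []; _∷_; _++_; length; map; filter; upTo; allFin; cartesianProduct; cartesianProductWith; deduplicate)
open import Data.List.Membership.Propositional using (_∈_)
open import Data.List.Membership.Propositional.Properties
  using (∈-cartesianProductWith⁻; ∈-upTo⁺; ∈-upTo⁻; ∈-allFin; ∈-map⁻; ∈-filter⁻)
open import Data.List.Properties
  using (map-++; map-∘; map-cong; map-cong-local; filter-all; filter-idem; filter-reject)
open import Data.List.Relation.Unary.All as All using (All; []; _∷_)
import Data.List.Relation.Unary.All.Properties as All
open import Data.List.Relation.Unary.AllPairs using ([]; _∷_)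
open import Data.List.Relation.Unary.Any using (here; there)
open import Data.List.Relation.Unary.Linked using (Linked; []; [-]; _∷_; linked?; tail)
open import Data.List.Relation.Unary.Linked.Properties using (Linked⇒All)
open import Data.List.Relation.Unary.Unique.Propositional using (Unique)
open import Data.List.Relation.Unary.Unique.Propositional.Properties using (upTo⁺; allFin⁺)
open import Data.Nat
open import Data.Nat.ListAction using (sum)
open import Data.Nat.ListAction.Properties using (sum-++)
open import Data.Nat.Properties
open import Algebra.Properties.CommutativeSemigroup +-commutativeSemigroup using (interchange)
open import Algebra.Properties.CommutativeSemigroup *-commutativeSemigroup
  using (x∙yz≈y∙xz) renaming (interchange to *-interchange)
open import Data.Product using (_×_; _,_; proj₁; proj₂)
open import Data.Vec as Vec using (Vec; []; _∷_; zipWith; lookup)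
import Data.Vec.Properties as Vec
open import Function using (_∘_; _⇔_; mk⇔)
open import Relation.Binary.PropositionalEquality
open import Relation.Nullary using (Dec; yes; no; ¬_; does; contradiction)
open import Relation.Nullary.Decidable using (_×-dec_; ¬?; does-⇔; dec-true; dec-false)
open import Relation.Unary using (Decidable)

open ≡-Reasoning

private variable
  A B C : Set
  P Q : Set
  k m : ℕ

-- Finite sums and indicators

∑ : List A → (A → ℕ) → ℕ
∑ as h = sum (map h as)

infix 5 ∑
syntax ∑ as (λ a → h) = ∑[ a ∈ as ] h

-- The Iverson bracket. It inspects only `does`, so decisions of equivalent propositions have equal
-- brackets whatever proofs they carry.
⟦_⟧ : Dec P → ℕ
⟦ d ⟧ = if does d then 1 else 0

⟦⟧-true : (d : Dec P) → P → ⟦ d ⟧ ≡ 1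
⟦⟧-true d p = cong (if_then 1 else 0) (dec-true d p)

⟦⟧-false : (d : Dec P) → ¬ P → ⟦ d ⟧ ≡ 0
⟦⟧-false d ¬p = cong (if_then 1 else 0) (dec-false d ¬p)

⟦⟧-⇔ : P ⇔ Q → (d : Dec P) (e : Dec Q) → ⟦ d ⟧ ≡ ⟦ e ⟧
⟦⟧-⇔ P⇔Q d e = cong (if_then 1 else 0) (does-⇔ P⇔Q d e)

⟦⟧-× : (d : Dec P) (e : Dec Q) → ⟦ d ×-dec e ⟧ ≡ ⟦ d ⟧ * ⟦ e ⟧
⟦⟧-× d e with does d | does e
... | true  | true  = refl
... | true  | false = refl
... | false | _     = refl

∑-cong : ∀ (as : List A) {g h : A → ℕ} → (∀ a → g a ≡ h a) → ∑ as g ≡ ∑ as h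
∑-cong as g≗h = cong sum (map-cong g≗h as)

∑-cong∈ : ∀ (as : List A) {g h : A → ℕ} → (∀ {a} → a ∈ as → g a ≡ h a) → ∑ as g ≡ ∑ as h
∑-cong∈ as g≗h = cong sum (map-cong-local (All.tabulate g≗h))

∑-map : ∀ (φ : A → B) as (h : B → ℕ) → ∑ (map φ as) h ≡ ∑ as (h ∘ φ)
∑-map φ as h = cong sum (sym (map-∘ as))

∑-++ : ∀ (as bs : List A) (h : A → ℕ) → ∑ (as ++ bs) h ≡ ∑ as h + ∑ bs h
∑-++ as bs h = trans (cong sum (map-++ h as bs)) (sum-++ (map h as) (map h bs))

∑-zero : ∀ (as : List A) → ∑[ _ ∈ as ] 0 ≡ 0
∑-zero []       = refl
∑-zero (_ ∷ as) = ∑-zero as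

∑-+ : ∀ (as : List A) (g h : A → ℕ) → ∑[ a ∈ as ] (g a + h a) ≡ ∑ as g + ∑ as h
∑-+ []       g h = refl
∑-+ (a ∷ as) g h = trans (cong (g a + h a +_) (∑-+ as g h)) (interchange (g a) (h a) _ _)

∑-*ˡ : ∀ n (as : List A) (h : A → ℕ) → n * ∑ as h ≡ ∑[ a ∈ as ] n * h a
∑-*ˡ n []       h = *-zeroʳ n
∑-*ˡ n (a ∷ as) h = trans (*-distribˡ-+ n (h a) _) (cong (n * h a +_) (∑-*ˡ n as h))

∑-*ʳ : ∀ n (as : List A) (h : A → ℕ) → ∑ as h * n ≡ ∑[ a ∈ as ] h a * n
∑-*ʳ n as h = begin
  ∑ as h * n             ≡⟨ *-comm _ n ⟩
  n * ∑ as h             ≡⟨ ∑-*ˡ n as h ⟩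
  (∑[ a ∈ as ] n * h a)  ≡⟨ ∑-cong as (λ a → *-comm n (h a)) ⟩
  (∑[ a ∈ as ] h a * n)  ∎

∑-swap : ∀ (as : List A) (bs : List B) (h : A → B → ℕ) →
  ∑[ a ∈ as ] ∑[ b ∈ bs ] h a b ≡ ∑[ b ∈ bs ] ∑[ a ∈ as ] h a b
∑-swap []       bs h = sym (∑-zero bs)
∑-swap (a ∷ as) bs h =
  trans (cong (∑ bs (h a) +_) (∑-swap as bs h)) (sym (∑-+ bs (h a) _))

∑-cartesianProductWith : ∀ (φ : A → B → C) as bs (h : C → ℕ) →
  ∑ (cartesianProductWith φ as bs) h ≡ ∑[ a ∈ as ] ∑[ b ∈ bs ] h (φ a b)
∑-cartesianProductWith φ []       bs h = refl
∑-cartesianProductWith φ (a ∷ as) bs h =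
  trans (∑-++ (map (φ a) bs) _ h)
        (cong₂ _+_ (∑-map (φ a) bs h) (∑-cartesianProductWith φ as bs h))

-- Sums over filtered lists and sums against an indicator.

module _ {R : A → Set} (R? : Decidable R) where

  ∑-filter : ∀ as (h : A → ℕ) → ∑ (filter R? as) h ≡ ∑[ a ∈ as ] ⟦ R? a ⟧ * h a
  ∑-filter []       h = refl
  ∑-filter (a ∷ as) h with does (R? a)
  ... | true  = cong₂ _+_ (sym (+-identityʳ (h a))) (∑-filter as h)
  ... | false = ∑-filter as h

  length-filter-∑ : ∀ as → length (filter R? as) ≡ ∑[ a ∈ as ] ⟦ R? a ⟧
  length-filter-∑ []       = refl
  length-filter-∑ (a ∷ as) with does (R? a)
  ... | true  = cong suc (length-filter-∑ as)
  ... | false = length-filter-∑ as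

module _ (_≟ᴬ_ : (a b : A) → Dec (a ≡ b)) (h : A → ℕ) where

  ∑-δ-∉ : ∀ {a} as → All (a ≢_) as → ∑[ b ∈ as ] ⟦ a ≟ᴬ b ⟧ * h b ≡ 0
  ∑-δ-∉         []       []         = refl
  ∑-δ-∉ {a = a} (b ∷ as) (a≢b ∷ ps) rewrite ⟦⟧-false (a ≟ᴬ b) a≢b = ∑-δ-∉ as ps

  -- Membership makes the term at `a` occur, and uniqueness makes it occur only once.
  ∑-δ : ∀ {a as} → Unique as → a ∈ as → ∑[ b ∈ as ] ⟦ a ≟ᴬ b ⟧ * h b ≡ h a
  ∑-δ {a} {_ ∷ as} (a∉ ∷ _) (here refl)
    rewrite ⟦⟧-true (a ≟ᴬ a) refl | ∑-δ-∉ as a∉ | +-identityʳ (h a) = +-identityʳ (h a)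
  ∑-δ {a} {b ∷ as} (b∉ ∷ u) (there a∈)
    rewrite ⟦⟧-false (a ≟ᴬ b) (λ { refl → All.lookup b∉ a∈ refl }) = ∑-δ u a∈

-- Power series

infixl 6 _+ᵛ_
_+ᵛ_ : Vec ℕ m → Vec ℕ m → Vec ℕ m
_+ᵛ_ = zipWith _+_

0ᵛ : Vec ℕ m
0ᵛ = Vec.replicate _ 0

unit : Fin m → Vec ℕ m
unit i = 0ᵛ Vec.[ i ]≔ 1

+ᵛ-identityʳ : (e : Vec ℕ m) → e +ᵛ 0ᵛ ≡ e
+ᵛ-identityʳ = Vec.zipWith-identityʳ +-identityʳ

monomial-⟦⟧ : (a e : Vec ℕ m) → monomial a e ≡ ⟦ Vec.≡-dec _≟_ a e ⟧
monomial-⟦⟧ a e with Vec.≡-dec _≟_ a e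
... | yes _ = refl
... | no  _ = refl

monomial-∷ : ∀ i (a : Vec ℕ m) j e → monomial (i ∷ a) (j ∷ e) ≡ ⟦ i ≟ j ⟧ * monomial a e
monomial-∷ i a j e = begin
  monomial (i ∷ a) (j ∷ e)              ≡⟨ monomial-⟦⟧ (i ∷ a) (j ∷ e) ⟩
  ⟦ Vec.≡-dec _≟_ (i ∷ a) (j ∷ e) ⟧     ≡⟨ ⟦⟧-⇔ (mk⇔ Vec.∷-injective λ { (refl , refl) → refl })
                                             (Vec.≡-dec _≟_ (i ∷ a) (j ∷ e)) (i ≟ j ×-dec Vec.≡-dec _≟_ a e) ⟩
  ⟦ i ≟ j ×-dec Vec.≡-dec _≟_ a e ⟧     ≡⟨ ⟦⟧-× (i ≟ j) (Vec.≡-dec _≟_ a e) ⟩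
  ⟦ i ≟ j ⟧ * ⟦ Vec.≡-dec _≟_ a e ⟧     ≡⟨ cong (⟦ i ≟ j ⟧ *_) (monomial-⟦⟧ a e) ⟨
  ⟦ i ≟ j ⟧ * monomial a e              ∎

-- The one-variable case of multiplying monomials: only the pair `(a , b)` can contribute, and it
-- lies on the antidiagonal of `n` exactly when `a + b ≡ n`.
∑-antidiagonal-δ : ∀ a b n →
  ∑[ ij ∈ antidiagonal n ] ⟦ a ≟ proj₁ ij ⟧ * ⟦ b ≟ proj₂ ij ⟧ ≡ ⟦ a + b ≟ n ⟧
∑-antidiagonal-δ a b n =
  trans (∑-map (λ i → i , n ∸ i) (upTo (suc n)) _) (lemma (a ≤? n))
  where
  lemma : Dec (a ≤ n) → ∑[ i ∈ upTo (suc n) ] ⟦ a ≟ i ⟧ * ⟦ b ≟ n ∸ i ⟧ ≡ ⟦ a + b ≟ n ⟧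
  -- The sum reduces to `i = a`; since `a ≤ n`, the subtraction in `n ∸ a` is not truncated.
  lemma (yes a≤n) =
    trans (∑-δ _≟_ (λ i → ⟦ b ≟ n ∸ i ⟧) (upTo⁺ (suc n)) (∈-upTo⁺ (s≤s a≤n)))
          (⟦⟧-⇔ (mk⇔ (λ b≡ → trans (cong (a +_) b≡) (m+[n∸m]≡n a≤n))
                     (λ a+b≡n → trans (sym (m+n∸m≡n a b)) (cong (_∸ a) a+b≡n)))
               (b ≟ n ∸ a) (a + b ≟ n))
  -- Here `a` lies outside the range of `i`, so every term vanishes, and `a + b` exceeds `n`.
  lemma (no a≰n) =
    trans (∑-δ-∉ _≟_ _ (upTo (suc n)) (All.tabulate λ { i∈ refl → a≰n (s≤s⁻¹ (∈-upTo⁻ i∈)) }))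
          (sym (⟦⟧-false (a + b ≟ n) λ { refl → a≰n (m≤m+n a b) }))

-- By induction on the number of variables: `splits` ranges over a product, so the convolution
-- factors into the one for the first variable and the one for the others.
monomial-⊗ : (a b : Vec ℕ m) → monomial a ⊗ monomial b ≗ monomial (a +ᵛ b)
monomial-⊗ []      []      []      = refl
monomial-⊗ (i ∷ a) (j ∷ b) (n ∷ e) = begin
  (monomial (i ∷ a) ⊗ monomial (j ∷ b)) (n ∷ e)
    ≡⟨ ∑-cartesianProductWith _ (antidiagonal n) (splits e) _ ⟩
  (∑[ ij ∈ antidiagonal n ] ∑[ uv ∈ splits e ]
    monomial (i ∷ a) (proj₁ ij ∷ proj₁ uv) * monomial (j ∷ b) (proj₂ ij ∷ proj₂ uv))
    ≡⟨ ∑-cong (antidiagonal n) (λ (i′ , j′) →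
         trans (∑-cong (splits e) λ (u , v) →
                  trans (cong₂ _*_ (monomial-∷ i a i′ u) (monomial-∷ j b j′ v))
                        (*-interchange ⟦ i ≟ i′ ⟧ (monomial a u) ⟦ j ≟ j′ ⟧ (monomial b v)))
               (sym (∑-*ˡ (⟦ i ≟ i′ ⟧ * ⟦ j ≟ j′ ⟧) (splits e) λ (u , v) → monomial a u * monomial b v))) ⟩
  (∑[ ij ∈ antidiagonal n ] ⟦ i ≟ proj₁ ij ⟧ * ⟦ j ≟ proj₂ ij ⟧ * (monomial a ⊗ monomial b) e)
    ≡⟨ ∑-*ʳ ((monomial a ⊗ monomial b) e) (antidiagonal n) (λ (i′ , j′) → ⟦ i ≟ i′ ⟧ * ⟦ j ≟ j′ ⟧) ⟨
  (∑[ ij ∈ antidiagonal n ] ⟦ i ≟ proj₁ ij ⟧ * ⟦ j ≟ proj₂ ij ⟧) * (monomial a ⊗ monomial b) e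
    ≡⟨ cong₂ _*_ (∑-antidiagonal-δ i j n) (monomial-⊗ a b e) ⟩
  ⟦ i + j ≟ n ⟧ * monomial (a +ᵛ b) e
    ≡⟨ monomial-∷ (i + j) (a +ᵛ b) n e ⟨
  monomial ((i ∷ a) +ᵛ (j ∷ b)) (n ∷ e) ∎

⊗-cong : {F F′ G G′ : Series m} → F ≗ F′ → G ≗ G′ → F ⊗ G ≗ F′ ⊗ G′
⊗-cong F≗F′ G≗G′ e = ∑-cong (splits e) λ (u , v) → cong₂ _*_ (F≗F′ u) (G≗G′ v)

-- Polynomials as sums of monomials.

sumˢ-map : ∀ (F : A → Series m) as → sumˢ (map F as) ≗ λ e → ∑[ a ∈ as ] F a e
sumˢ-map F []       e = refl
sumˢ-map F (a ∷ as) e = cong (F a e +_) (sumˢ-map F as e)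

∑ᵐ : List A → (A → Vec ℕ m) → Series m
∑ᵐ as w e = ∑[ a ∈ as ] monomial (w a) e

-- Convolution is bilinear, so the product expands into all pairs of monomials, and each pair
-- multiplies by adding exponents.
∑ᵐ-⊗ : ∀ (as : List A) (bs : List B) (v : A → Vec ℕ m) w →
  ∑ᵐ as v ⊗ ∑ᵐ bs w ≗ λ e → ∑[ a ∈ as ] ∑[ b ∈ bs ] monomial (v a +ᵛ w b) e
∑ᵐ-⊗ as bs v w e = begin
  (∑[ s ∈ splits e ] ∑ᵐ as v (proj₁ s) * ∑ᵐ bs w (proj₂ s))
    ≡⟨ ∑-cong (splits e) (λ s →
         trans (∑-*ʳ (∑ᵐ bs w (proj₂ s)) as (λ a → monomial (v a) (proj₁ s)))
               (∑-cong as λ a → ∑-*ˡ (monomial (v a) (proj₁ s)) bs (λ b → monomial (w b) (proj₂ s)))) ⟩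
  (∑[ s ∈ splits e ] ∑[ a ∈ as ] ∑[ b ∈ bs ] monomial (v a) (proj₁ s) * monomial (w b) (proj₂ s))
    ≡⟨ ∑-swap (splits e) as _ ⟩
  (∑[ a ∈ as ] ∑[ s ∈ splits e ] ∑[ b ∈ bs ] monomial (v a) (proj₁ s) * monomial (w b) (proj₂ s))
    ≡⟨ ∑-cong as (λ a → trans (∑-swap (splits e) bs _)
                              (∑-cong bs λ b → monomial-⊗ (v a) (w b) e)) ⟩
  (∑[ a ∈ as ] ∑[ b ∈ bs ] monomial (v a +ᵛ w b) e) ∎

-- The exponent vectors of the k ^ r terms in the expansion of (x₁ + ⋯ + x_k) ^ r,
-- with repetitions.
powerTerms : ∀ k → ℕ → List (Vec ℕ k)
powerTerms k zero    = 0ᵛ ∷ []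
powerTerms k (suc r) = cartesianProductWith (λ c e → unit c +ᵛ e) (allFin k) (powerTerms k r)

-- The prefixed `0` is the exponent of `q`.
power-of-sum : ∀ k r → sumˢ (map x (allFin k)) ^ˢ r ≗ ∑ᵐ (powerTerms k r) (0 ∷_)
power-of-sum k zero    e = sym (+-identityʳ _)
power-of-sum k (suc r) e = begin
  (sumˢ (map x (allFin k)) ⊗ sumˢ (map x (allFin k)) ^ˢ r) e
    ≡⟨ ⊗-cong (sumˢ-map x (allFin k)) (power-of-sum k r) e ⟩
  (∑ᵐ (allFin k) (λ c → 0 ∷ unit c) ⊗ ∑ᵐ (powerTerms k r) (0 ∷_)) e
    ≡⟨ ∑ᵐ-⊗ (allFin k) (powerTerms k r) _ _ e ⟩
  (∑[ c ∈ allFin k ] ∑[ v ∈ powerTerms k r ] monomial (0 ∷ unit c +ᵛ v) e)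
    ≡⟨ ∑-cartesianProductWith _ (allFin k) (powerTerms k r) _ ⟨
  ∑ᵐ (powerTerms k (suc r)) (0 ∷_) e ∎

power-of-q : ∀ n → q {k} ^ˢ n ≗ monomial (n ∷ 0ᵛ)
power-of-q zero    e = refl
power-of-q (suc n) e = begin
  (q ⊗ q ^ˢ n) e                        ≡⟨ ⊗-cong {F = q} (λ _ → refl) (power-of-q n) e ⟩
  (q ⊗ monomial (n ∷ 0ᵛ)) e             ≡⟨ monomial-⊗ (1 ∷ 0ᵛ) (n ∷ 0ᵛ) e ⟩
  monomial (suc n ∷ 0ᵛ +ᵛ 0ᵛ) e         ≡⟨ cong (λ v → monomial (suc n ∷ v) e) (+ᵛ-identityʳ 0ᵛ) ⟩
  monomial (suc n ∷ 0ᵛ) e               ∎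

-- Distinct parts of a partition

#distinct-fresh : ∀ {s ps} → All (s ≢_) ps → #distinct (s ∷ ps) ≡ suc (#distinct ps)
#distinct-fresh s∉ = cong (suc ∘ length) (filter-all _ (All.deduplicate⁺ _≟_ s∉))

-- Deduplication filters `s` out of the tail once for each copy; the first filter also drops the
-- second copy, and filtering twice is the same as filtering once.
#distinct-again : ∀ s ps → #distinct (s ∷ s ∷ ps) ≡ #distinct (s ∷ ps)
#distinct-again s ps = cong (suc ∘ length)
  (trans (filter-reject (¬? ∘ (s ≟_)) (λ s≢s → s≢s refl)) (filter-idem (¬? ∘ (s ≟_)) (deduplicate _≟_ ps)))

-- A view of weakly decreasing lists that separates a part of a new size from a repetition of the
-- next part; the inductions on a partition follow these two cases.
data Descending : List ℕ → Set where
  []    : Descending []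
  fresh : ∀ {s ps} → All (_< s) ps → Descending ps → Descending (s ∷ ps)
  again : ∀ {s ps} → Descending (s ∷ ps) → Descending (s ∷ s ∷ ps)

descending : ∀ {ps} → Linked _≥_ ps → Descending ps
descending []  = []
descending [-] = fresh [] []
descending {s ∷ s′ ∷ ps} (s≥s′ ∷ l) with s ≟ s′
... | yes refl = again (descending l)
-- All later parts are at most `s′`, which is strictly below `s`.
... | no  s≢s′ = fresh (All.map (λ ≤s′ → ≤-<-trans ≤s′ (≤∧≢⇒< s≥s′ (s≢s′ ∘ sym)))
                                (Linked⇒All (λ i≥j j≥l → ≤-trans j≥l i≥j) ≤-refl l))
                       (descending l)

<⇒All≢ : ∀ {s ps} → All (_< s) ps → All (s ≢_) ps
<⇒All≢ = All.map (λ t<s s≡t → <⇒≢ t<s (sym s≡t))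

#distinct≤length : ∀ {ps} → Descending ps → #distinct ps ≤ length ps
#distinct≤length []                        = z≤n
#distinct≤length (fresh s> d)
  rewrite #distinct-fresh (<⇒All≢ s>)      = s≤s (#distinct≤length d)
#distinct≤length (again {s} {ps} d)
  rewrite #distinct-again s ps             = m≤n⇒m≤1+n (#distinct≤length d)

#distinct≤max : ∀ {ps M} → Descending ps → All (λ s → 0 < s × s ≤ M) ps → #distinct ps ≤ M
#distinct≤max []                _                                  = z≤n
#distinct≤max (fresh {suc s} s> d) ((_ , s<M) ∷ bs)
  rewrite #distinct-fresh (<⇒All≢ s>) =
  -- Below a fresh part `suc s` all parts are at most `s`, so the induction runs with the bound `s`
  -- in place of `M`.
  ≤-trans (s≤s (#distinct≤max d (All.zipWith (λ ((0< , _) , <s) → 0< , s≤s⁻¹ <s) (bs , s>)))) s<M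
#distinct≤max (again {s} {ps} d) (_ ∷ bs)
  rewrite #distinct-again s ps = #distinct≤max d bs

#distinct≤⊓ : ∀ M N {ps} → ps ∈ words≤ N (sizes M) → Descending ps → #distinct ps ≤ M ⊓ N
#distinct≤⊓ M N ps∈ d with l , ps⊆ ← ∈-words≤⁻ N (sizes M) ps∈ =
  ⊓-glb (#distinct≤max d (All.map bounds ps⊆)) (≤-trans (#distinct≤length d) l)
  where
  bounds : ∀ {s} → s ∈ sizes M → 0 < s × s ≤ M
  bounds s∈ with _ , i∈ , refl ← ∈-map⁻ suc s∈ = z<s , ∈-upTo⁻ i∈

-- Colorings of a partition

colorings : List B → List A → List (List (A × B))
colorings bs []       = [] ∷ []
colorings bs (a ∷ as) = cartesianProductWith (λ b π → (a , b) ∷ π) bs (colorings bs as)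

map-proj₁-colorings : ∀ (bs : List B) (as : List A) {π} → π ∈ colorings bs as → map proj₁ π ≡ as
map-proj₁-colorings bs []       (here refl) = refl
map-proj₁-colorings bs (a ∷ as) π∈
  with _ , _ , _ , ρ∈ , refl ← ∈-cartesianProductWith⁻ _ bs (colorings bs as) π∈ =
  cong (a ∷_) (map-proj₁-colorings bs as ρ∈)

-- A word of pairs is a word of first components together with a labelling of it. Grouping by the
-- former collects the colored lists over each fixed list of sizes.
∑-words≤-cartesianProduct : ∀ N (as : List A) (bs : List B) h →
  ∑ (words≤ N (cartesianProduct as bs)) h ≡ ∑[ w ∈ words≤ N as ] ∑ (colorings bs w) h
∑-words≤-cartesianProduct zero    as bs h = sym (+-identityʳ _)
∑-words≤-cartesianProduct (suc N) as bs h = cong₂ _+_ (sym (+-identityʳ _)) (begin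
  ∑ (cartesianProductWith _∷_ (cartesianProduct as bs) (words≤ N (cartesianProduct as bs))) h
    ≡⟨ ∑-cartesianProductWith _∷_ (cartesianProduct as bs) _ h ⟩
  (∑[ ab ∈ cartesianProduct as bs ] ∑[ π ∈ words≤ N (cartesianProduct as bs) ] h (ab ∷ π))
    ≡⟨ ∑-cartesianProductWith _,_ as bs _ ⟩
  (∑[ a ∈ as ] ∑[ b ∈ bs ] ∑[ π ∈ words≤ N (cartesianProduct as bs) ] h ((a , b) ∷ π))
    ≡⟨ ∑-cong as (λ a → trans
         (∑-cong bs λ b → ∑-words≤-cartesianProduct N as bs (h ∘ ((a , b) ∷_)))
         (∑-swap bs (words≤ N as) _)) ⟩
  (∑[ a ∈ as ] ∑[ w ∈ words≤ N as ] ∑[ b ∈ bs ] ∑[ π ∈ colorings bs w ] h ((a , b) ∷ π))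
    ≡⟨ ∑-cong as (λ a → ∑-cong (words≤ N as) λ w →
         ∑-cartesianProductWith _ bs (colorings bs w) h) ⟨
  (∑[ a ∈ as ] ∑[ w ∈ words≤ N as ] ∑ (colorings bs (a ∷ w)) h)
    ≡⟨ ∑-cartesianProductWith _∷_ as (words≤ N as) _ ⟨
  (∑[ w ∈ cartesianProductWith _∷_ as (words≤ N as) ] ∑ (colorings bs w) h) ∎)

-- Effect of prepending a part on color type and validity.

sizesOfColor : Fin k → List (ℕ × Fin k) → List ℕ
sizesOfColor i π = map proj₁ (filter (λ part → proj₂ part Fin.≟ i) π)

colorType-[] : colorType {k} [] ≡ 0ᵛ
colorType-[] = trans (Vec.tabulate-cong λ i → sym (Vec.lookup-replicate i 0)) (Vec.tabulate∘lookup 0ᵛ)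

-- Only the entry of color `c` sees the new part, and `s` is new among the sizes of that color too.
colorType-fresh : ∀ {s} c (π : List (ℕ × Fin k)) → All (s ≢_) (map proj₁ π) →
  colorType ((s , c) ∷ π) ≡ unit c +ᵛ colorType π
colorType-fresh {s = s} c π s∉ = trans (Vec.tabulate-cong entry) (Vec.tabulate∘lookup _)
  where
  entry : ∀ i → #distinct (sizesOfColor i ((s , c) ∷ π)) ≡ lookup (unit c +ᵛ colorType π) i
  entry i
    rewrite Vec.lookup-zipWith _+_ i (unit c) (colorType π)
          | Vec.lookup∘tabulate (λ j → #distinct (sizesOfColor j π)) i
    with c Fin.≟ i
  ... | yes refl rewrite Vec.lookup∘update c 0ᵛ 1 =
        #distinct-fresh (All.map⁺ (All.filter⁺ _ (All.map⁻ s∉)))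
  ... | no c≢i rewrite Vec.lookup∘update′ (c≢i ∘ sym) 0ᵛ 1 | Vec.lookup-replicate i 0 = refl

colorType-again : ∀ s c (π : List (ℕ × Fin k)) →
  colorType ((s , c) ∷ (s , c) ∷ π) ≡ colorType ((s , c) ∷ π)
colorType-again s c π = Vec.tabulate-cong entry
  where
  entry : ∀ i →
    #distinct (sizesOfColor i ((s , c) ∷ (s , c) ∷ π)) ≡ #distinct (sizesOfColor i ((s , c) ∷ π))
  entry i with does (c Fin.≟ i) in eq
  ... | true  rewrite eq = #distinct-again s (sizesOfColor i π)
  ... | false rewrite eq = refl

-- A strictly larger first part satisfies the order condition, and no later part has its size, so
-- its color is free.
isColored-fresh : ∀ {s c} (π : List (ℕ × Fin k)) → All (_< s) (map proj₁ π) →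
  IsColored ((s , c) ∷ π) ⇔ IsColored π
isColored-fresh π s> = mk⇔
  (λ { (l , _ ∷ u) → tail l , u })
  (λ (l , u) → cons s> l , All.map (λ t<s s≡t → contradiction (sym s≡t) (<⇒≢ t<s)) (All.map⁻ s>) ∷ u)
  where
  cons : ∀ {s ps} → All (_< s) ps → Linked _≥_ ps → Linked _≥_ (s ∷ ps)
  cons []      _ = [-]
  cons (t<s ∷ _) l = <⇒≤ t<s ∷ l

isColored-again : ∀ {s c} (π : List (ℕ × Fin k)) →
  IsColored ((s , c) ∷ (s , c) ∷ π) ⇔ IsColored ((s , c) ∷ π)
isColored-again π = mk⇔
  (λ { (_ ∷ l , _ ∷ u) → l , u })
  (λ { (l , h ∷ u) → ≤-refl ∷ l , ((λ _ → refl) ∷ h) ∷ h ∷ u })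

colorWeight : (Vec ℕ k → ℕ) → List (ℕ × Fin k) → ℕ
colorWeight g π = ⟦ isColored? π ⟧ * g (colorType π)

colorWeight-fresh : ∀ (g : Vec ℕ k → ℕ) {s} c π → All (_< s) (map proj₁ π) →
  colorWeight g ((s , c) ∷ π) ≡ colorWeight (λ e → g (unit c +ᵛ e)) π
colorWeight-fresh g c π s> = cong₂ _*_
  (⟦⟧-⇔ (isColored-fresh π s>) (isColored? _) (isColored? π))
  (cong g (colorType-fresh c π (<⇒All≢ s>)))

-- Parts of equal size must agree in color; when they do, the extra copy changes neither validity
-- nor color type.
colorWeight-again : ∀ (g : Vec ℕ k → ℕ) s c c′ π →
  colorWeight g ((s , c) ∷ (s , c′) ∷ π) ≡ ⟦ c Fin.≟ c′ ⟧ * colorWeight g ((s , c′) ∷ π)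
colorWeight-again {k} g s c c′ π = lemma (c Fin.≟ c′)
  where
  extended : List (ℕ × Fin k)
  extended = (s , c) ∷ (s , c′) ∷ π

  lemma : Dec (c ≡ c′) →
    colorWeight g extended ≡ ⟦ c Fin.≟ c′ ⟧ * colorWeight g ((s , c′) ∷ π)
  lemma (yes refl) = begin
    colorWeight g extended
      ≡⟨ cong₂ _*_ (⟦⟧-⇔ (isColored-again π) (isColored? extended) (isColored? ((s , c) ∷ π)))
                   (cong g (colorType-again s c π)) ⟩
    colorWeight g ((s , c) ∷ π)
      ≡⟨ *-identityˡ _ ⟨
    1 * colorWeight g ((s , c) ∷ π)
      ≡⟨ cong (_* colorWeight g ((s , c) ∷ π)) (⟦⟧-true (c Fin.≟ c) refl) ⟨
    ⟦ c Fin.≟ c ⟧ * colorWeight g ((s , c) ∷ π) ∎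
  lemma (no c≢c′) = begin
    colorWeight g extended
      ≡⟨ cong (_* g (colorType extended))
              (⟦⟧-false (isColored? extended) λ { (_ , (c≡c′ ∷ _) ∷ _) → c≢c′ (c≡c′ refl) }) ⟩
    0
      ≡⟨ cong (_* colorWeight g ((s , c′) ∷ π)) (⟦⟧-false (c Fin.≟ c′) c≢c′) ⟨
    ⟦ c Fin.≟ c′ ⟧ * colorWeight g ((s , c′) ∷ π) ∎

-- The core count: valid colorings of `ps`, taken by color type, match the terms of the expanded
-- power of `x₁ + ⋯ + x_k`. The function `g` is arbitrary because a fresh part of color `c` calls
-- the induction hypothesis with `g` shifted by `unit c`.
∑-colorWeight : ∀ {ps} → Descending ps → (g : Vec ℕ k → ℕ) →
  ∑ (colorings (allFin k) ps) (colorWeight g) ≡ ∑ (powerTerms k (#distinct ps)) g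
∑-colorWeight [] g = cong (_+ 0) (trans (+-identityʳ _) (cong g colorType-[]))
∑-colorWeight {k} {s ∷ ps} (fresh s> d) g = begin
  ∑ (colorings (allFin k) (s ∷ ps)) (colorWeight g)
    ≡⟨ ∑-cartesianProductWith _ (allFin k) _ _ ⟩
  (∑[ c ∈ allFin k ] ∑[ π ∈ colorings (allFin k) ps ] colorWeight g ((s , c) ∷ π))
    ≡⟨ ∑-cong (allFin k) (λ c → trans
         (∑-cong∈ (colorings (allFin k) ps) λ {π} π∈ → colorWeight-fresh g c π
            (subst (All (_< s)) (sym (map-proj₁-colorings (allFin k) ps π∈)) s>))
         (∑-colorWeight d (λ e → g (unit c +ᵛ e)))) ⟩
  (∑[ c ∈ allFin k ] ∑[ e ∈ powerTerms k (#distinct ps) ] g (unit c +ᵛ e))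
    ≡⟨ ∑-cartesianProductWith _ (allFin k) (powerTerms k (#distinct ps)) g ⟨
  ∑ (powerTerms k (suc (#distinct ps))) g
    ≡⟨ cong (λ d → ∑ (powerTerms k d) g) (#distinct-fresh (<⇒All≢ s>)) ⟨
  ∑ (powerTerms k (#distinct (s ∷ ps))) g ∎
∑-colorWeight {k} (again {s} {ps} d) g = begin
  ∑ (colorings (allFin k) (s ∷ s ∷ ps)) (colorWeight g)
    ≡⟨ ∑-cartesianProductWith _ (allFin k) _ _ ⟩
  (∑[ c ∈ allFin k ] ∑[ π ∈ colorings (allFin k) (s ∷ ps) ] colorWeight g ((s , c) ∷ π))
    ≡⟨ ∑-cong (allFin k) (λ c → begin
      (∑[ π ∈ colorings (allFin k) (s ∷ ps) ] colorWeight g ((s , c) ∷ π))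
        ≡⟨ ∑-cartesianProductWith _ (allFin k) (colorings (allFin k) ps) _ ⟩
      (∑[ c′ ∈ allFin k ] ∑[ π ∈ colorings (allFin k) ps ] colorWeight g ((s , c) ∷ (s , c′) ∷ π))
        ≡⟨ ∑-cong (allFin k) (λ c′ → trans
             (∑-cong (colorings (allFin k) ps) (colorWeight-again g s c c′))
             (sym (∑-*ˡ ⟦ c Fin.≟ c′ ⟧ (colorings (allFin k) ps) _))) ⟩
      (∑[ c′ ∈ allFin k ] ⟦ c Fin.≟ c′ ⟧ *
        (∑[ π ∈ colorings (allFin k) ps ] colorWeight g ((s , c′) ∷ π)))
        -- Only `c′ = c` survives, so the two color choices collapse into one.
        ≡⟨ ∑-δ Fin._≟_ _ (allFin⁺ k) (∈-allFin c) ⟩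
      (∑[ π ∈ colorings (allFin k) ps ] colorWeight g ((s , c) ∷ π)) ∎) ⟩
  (∑[ c ∈ allFin k ] ∑[ π ∈ colorings (allFin k) ps ] colorWeight g ((s , c) ∷ π))
    ≡⟨ ∑-cartesianProductWith _ (allFin k) (colorings (allFin k) ps) _ ⟨
  ∑ (colorings (allFin k) (s ∷ ps)) (colorWeight g)
    ≡⟨ ∑-colorWeight d g ⟩
  ∑ (powerTerms k (#distinct (s ∷ ps))) g
    ≡⟨ cong (λ d → ∑ (powerTerms k d) g) (#distinct-again s ps) ⟨
  ∑ (powerTerms k (#distinct (s ∷ s ∷ ps))) g ∎

-- Comparison of coefficients

-- The coefficient of xᵗ qⁿ in (x₁ + ⋯ + x_k) ^ r q ^ |ps|.
term : Vec ℕ k → ℕ → List ℕ → ℕ → ℕ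
term {k} t n ps r = ⟦ sum ps ≟ n ⟧ * (∑[ e ∈ powerTerms k r ] ⟦ Vec.≡-dec _≟_ e t ⟧)

-- The colored partitions are grouped by their underlying list of sizes, and the colorings of each
-- list are then summed.
p-expansion : ∀ M N (t : Vec ℕ k) n →
  p M N t n ≡ ∑[ ps ∈ boxPartitions M N ] term t n ps (#distinct ps)
p-expansion {k} M N t n = begin
  p M N t n
    ≡⟨ length-filter-∑ counted? (coloredBoxPartitions k M N) ⟩
  (∑[ π ∈ coloredBoxPartitions k M N ] ⟦ counted? π ⟧)
    ≡⟨ ∑-filter isColored? (words≤ N (cartesianProduct (sizes M) (allFin k))) (λ π → ⟦ counted? π ⟧) ⟩
  (∑[ π ∈ words≤ N (cartesianProduct (sizes M) (allFin k)) ] weight π)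
    ≡⟨ ∑-words≤-cartesianProduct N (sizes M) (allFin k) weight ⟩
  (∑[ ps ∈ words≤ N (sizes M) ] ∑ (colorings (allFin k) ps) weight)
    ≡⟨ ∑-cong (words≤ N (sizes M)) perPartition ⟩
  (∑[ ps ∈ words≤ N (sizes M) ] ⟦ linked? _≥?_ ps ⟧ * term t n ps (#distinct ps))
    ≡⟨ ∑-filter (linked? _≥?_) (words≤ N (sizes M)) _ ⟨
  (∑[ ps ∈ boxPartitions M N ] term t n ps (#distinct ps)) ∎
  where
  counted? : (π : List (ℕ × Fin k)) → Dec (colorType π ≡ t × size π ≡ n)
  counted? π = Vec.≡-dec _≟_ (colorType π) t ×-dec (size π ≟ n)

  weight : List (ℕ × Fin k) → ℕ
  weight π = ⟦ isColored? π ⟧ * ⟦ counted? π ⟧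

  hasType : Vec ℕ k → ℕ
  hasType e = ⟦ Vec.≡-dec _≟_ e t ⟧

  -- The size depends on `ps` alone, so its indicator can leave the sum over colorings.
  weight-factor : ∀ {ps π} → map proj₁ π ≡ ps → weight π ≡ ⟦ sum ps ≟ n ⟧ * colorWeight hasType π
  weight-factor {_} {π} refl = begin
    weight π
      ≡⟨ cong (⟦ isColored? π ⟧ *_)
           (trans (⟦⟧-× (Vec.≡-dec _≟_ (colorType π) t) (size π ≟ n)) (*-comm (hasType (colorType π)) _)) ⟩
    ⟦ isColored? π ⟧ * (⟦ size π ≟ n ⟧ * hasType (colorType π))
      ≡⟨ x∙yz≈y∙xz ⟦ isColored? π ⟧ ⟦ size π ≟ n ⟧ _ ⟩
    ⟦ size π ≟ n ⟧ * colorWeight hasType π ∎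

  perPartition : ∀ ps →
    ∑ (colorings (allFin k) ps) weight ≡ ⟦ linked? _≥?_ ps ⟧ * term t n ps (#distinct ps)
  perPartition ps with linked? _≥?_ ps
  ... | yes l = begin
    ∑ (colorings (allFin k) ps) weight
      ≡⟨ ∑-cong∈ _ (λ π∈ → weight-factor (map-proj₁-colorings (allFin k) ps π∈)) ⟩
    (∑[ π ∈ colorings (allFin k) ps ] ⟦ sum ps ≟ n ⟧ * colorWeight hasType π)
      ≡⟨ ∑-*ˡ ⟦ sum ps ≟ n ⟧ (colorings (allFin k) ps) _ ⟨
    ⟦ sum ps ≟ n ⟧ * ∑ (colorings (allFin k) ps) (colorWeight hasType)
      ≡⟨ cong (⟦ sum ps ≟ n ⟧ *_) (∑-colorWeight (descending l) hasType) ⟩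
    term t n ps (#distinct ps)
      ≡⟨ +-identityʳ _ ⟨
    1 * term t n ps (#distinct ps) ∎
  -- No labelling of a list that is not weakly decreasing is valid, so all weights vanish.
  ... | no ¬l = trans
    (∑-cong∈ _ (λ {π} π∈ → cong (_* ⟦ counted? π ⟧) (⟦⟧-false (isColored? π)
       λ (l , _) → ¬l (subst (Linked _≥_) (map-proj₁-colorings (allFin k) ps π∈) l))))
    (∑-zero (colorings (allFin k) ps))

-- The two factors involve disjoint variables: the exponent of `q` comes from the partition, those
-- of the colors from the power.
power⊗f-expansion : ∀ M N r n (t : Vec ℕ k) →
  (sumˢ (map x (allFin k)) ^ˢ r ⊗ f M N r) (n ∷ t) ≡
  ∑[ ps ∈ boxPartitions M N ] ⟦ #distinct ps ≟ r ⟧ * term t n ps r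
power⊗f-expansion {k} M N r n t = begin
  (sumˢ (map x (allFin k)) ^ˢ r ⊗ f M N r) (n ∷ t)
    ≡⟨ ⊗-cong (power-of-sum k r) f≗ (n ∷ t) ⟩
  (∑ᵐ (powerTerms k r) (0 ∷_) ⊗ ∑ᵐ partitions (λ ps → sum ps ∷ 0ᵛ)) (n ∷ t)
    ≡⟨ ∑ᵐ-⊗ (powerTerms k r) partitions _ _ (n ∷ t) ⟩
  (∑[ e ∈ powerTerms k r ] ∑[ ps ∈ partitions ] monomial (sum ps ∷ e +ᵛ 0ᵛ) (n ∷ t))
    ≡⟨ ∑-swap (powerTerms k r) partitions _ ⟩
  (∑[ ps ∈ partitions ] ∑[ e ∈ powerTerms k r ] monomial (sum ps ∷ e +ᵛ 0ᵛ) (n ∷ t))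
    ≡⟨ ∑-cong partitions (λ ps → trans
         (∑-cong (powerTerms k r) λ e → trans
            (monomial-∷ (sum ps) (e +ᵛ 0ᵛ) n t)
            (cong (⟦ sum ps ≟ n ⟧ *_)
                  (trans (cong (λ v → monomial v t) (+ᵛ-identityʳ e)) (monomial-⟦⟧ e t))))
         (sym (∑-*ˡ ⟦ sum ps ≟ n ⟧ (powerTerms k r) _))) ⟩
  (∑[ ps ∈ partitions ] term t n ps r)
    ≡⟨ ∑-filter (λ ps → #distinct ps ≟ r) (boxPartitions M N) _ ⟩
  (∑[ ps ∈ boxPartitions M N ] ⟦ #distinct ps ≟ r ⟧ * term t n ps r) ∎
  where
  partitions : List (List ℕ)
  partitions = filter (λ ps → #distinct ps ≟ r) (boxPartitions M N)

  f≗ : f {k} M N r ≗ ∑ᵐ partitions (λ ps → sum ps ∷ 0ᵛ)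
  f≗ e = trans (sumˢ-map _ partitions e) (∑-cong partitions λ ps → power-of-q (sum ps) e)

theorem3 : (M N k : ℕ) .{{_ : NonZero M}} .{{_ : NonZero N}} .{{_ : NonZero k}} →
    genFun {k} (p M N)
    ≗ sumˢ (map (λ r → sumˢ (map x (allFin k)) ^ˢ r ⊗ f M N r) (upTo (suc (M ⊓ N))))
theorem3 M N k (n ∷ t) = begin
  p M N t n
    ≡⟨ p-expansion M N t n ⟩
  (∑[ ps ∈ boxPartitions M N ] term t n ps (#distinct ps))
    -- The value `#distinct ps` is at most `M ⊓ N`, so it occurs exactly once in the range of `r`,
    -- whose `suc` includes the endpoint `M ⊓ N`; the indicator selects it.
    ≡⟨ ∑-cong∈ (boxPartitions M N) (λ {ps} ps∈ →
         let ps∈words , l = ∈-filter⁻ (linked? _≥?_) ps∈ in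
         ∑-δ _≟_ (term t n ps) (upTo⁺ (suc (M ⊓ N)))
             (∈-upTo⁺ (s≤s (#distinct≤⊓ M N ps∈words (descending l))))) ⟨
  (∑[ ps ∈ boxPartitions M N ] ∑[ r ∈ upTo (suc (M ⊓ N)) ] ⟦ #distinct ps ≟ r ⟧ * term t n ps r)
    ≡⟨ ∑-swap (boxPartitions M N) (upTo (suc (M ⊓ N))) _ ⟩
  (∑[ r ∈ upTo (suc (M ⊓ N)) ] ∑[ ps ∈ boxPartitions M N ] ⟦ #distinct ps ≟ r ⟧ * term t n ps r)
    ≡⟨ ∑-cong (upTo (suc (M ⊓ N))) (λ r → power⊗f-expansion M N r n t) ⟨
  (∑[ r ∈ upTo (suc (M ⊓ N)) ] (sumˢ (map x (allFin k)) ^ˢ r ⊗ f M N r) (n ∷ t))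
    ≡⟨ sumˢ-map _ (upTo (suc (M ⊓ N))) (n ∷ t) ⟨
  sumˢ (map (λ r → sumˢ (map x (allFin k)) ^ˢ r ⊗ f M N r) (upTo (suc (M ⊓ N)))) (n ∷ t) ∎
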